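{- Let $\Sigma_1=(G_1,\sigma_1)$ and $\Sigma_2=(G_2,\sigma_2)$ be two finite, simple, connected signed graphs, where $\Sigma_2$ is all-positive. Then the HG-lexicographic product satisfies $\operatorname{bdim}(\Sigma_1[\Sigma_2])=\operatorname{bdim}(\Sigma_1)$.
   Context: A signed graph $\Sigma=(G,\sigma)$ is a graph $G=(V,E)$ with a function $\sigma:E\to\{+1,-1\}$; it is all-positive if every edge has sign $+1$. All graphs are finite, simple, connected and undirected unless otherwise mentioned. Let $\Omega=\{ -1,0,1\}$, with $\Omega^k\subset\mathbb{R}^k$ carrying the standard inner product $\langle\cdot,\cdot\rangle$. A vector valued switching function ($k$-switching function) for $\Sigma$ is a map $\zeta:V\to\Omega^k$ with $\langle\zeta(u),\zeta(v)\rangle\neq 0$ for every edge $uv\in E$; the switched signed graph $\Sigma^\zeta=(G,\sigma^\zeta)$ has $\sigma^\zeta(uv)=\sigma(uv)\operatorname{sgn}(\langle\zeta(u),\zeta(v)\rangle)$. The balancing dimension $\operatorname{bdim}(\Sigma)$ is the least integer $k\ge 1$ for which there is a $k$-switching function $\zeta:V\to\Omega^k$ such that $\Sigma^\zeta$ is all-positive. The lexicographic product $G_1[G_2]$ of graphs has vertex set $V(G_1)\times V(G_2)$, with $(u_i,v_j)$ adjacent to $(u_k,v_l)$ iff $u_i\sim u_k$ in $G_1$, or $u_i=u_k$ and $v_j\sim v_l$ in $G_2$. The HG-lexicographic product $\Sigma_1[\Sigma_2]$ is the signed graph on $G_1[G_2]$ with signature $\sigma((u_i,v_j)(u_k,v_l))=\sigma_1(u_iu_k)$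 if $i\ne k$, and $=\sigma_2(v_jv_l)$ if $i=k$. -}

module Defs where

open import Data.Fin as Fin using (Fin)
open import Data.Fin.Properties as Fin using (*↔×)
open import Data.Integer as ℤ using (ℤ; 0ℤ; 1ℤ; -1ℤ; sign; _◃_)
open import Data.Integer.Properties as ℤ using ()
open import Data.List as List using (List; []; _∷_)
open import Data.List.Membership.Propositional using (_∈_)
open import Data.List.Membership.Propositional.Properties
  using (∈-allFin; ∈-map⁺; ∈-cartesianProduct⁺)
open import Data.List.Relation.Unary.Any using (here; there)
open import Data.Nat as ℕ using (ℕ; zero; suc; _≤_; s≤s; z≤n)
open import Data.Nat.Properties as ℕ using ()
open import Data.Product using (Σ; _×_; _,_; ∃; proj₁; proj₂)
open import Data.Product.Function.NonDependent.Propositional using (_×-↔_)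
open import Data.Sign as Sign using (Sign)
open import Data.Sign.Properties as Sign using ()
open import Data.Sum using (_⊎_; inj₁; inj₂; [_,_])
open import Data.Vec as Vec using (Vec; []; _∷_)
open import Data.Vec.Properties as Vec using ()
open import Function using (_∘_; _↔_; Inverse)
open import Function.Properties.Inverse using (↔-sym; ↔-trans; ↔⇒↣)
open import Relation.Binary using (Decidable; DecidableEquality; Symmetric)
open import Relation.Binary.Construct.Closure.ReflexiveTransitive using (Star)
open import Relation.Binary.PropositionalEquality
  using (_≡_; _≢_; refl; sym; trans; cong; cong₂; subst; subst₂)
open import Relation.Nullary using (¬_; Dec; yes; no; ¬?; contradiction)
open import Relation.Nullary.Decidable using (map′; via-injection; _×-dec_; _⊎-dec_)

record Graph : Set₁ where
  infix 4 _~_ _~?_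
  field
    V        : Set
    order    : ℕ
    finite   : V ↔ Fin order
    _~_      : V → V → Set
    _~?_     : Decidable _~_
    ~-sym    : Symmetric _~_
    ~-irrefl : ∀ {u} → ¬ (u ~ u)

  infix 4 _≟_
  _≟_ : DecidableEquality V
  _≟_ = via-injection (↔⇒↣ finite) Fin._≟_

-- The null graph is not counted as connected.
record Connected (G : Graph) : Set where
  open Graph G
  field
    nonempty : V
    path     : ∀ u v → Star _~_ u v

-- An undirected edge uv is witnessed by any proof of u ~ v or of v ~ u.
-- By σ-edge (and symmetry of ~) the sign depends only on {u, v}, not on the
-- orientation or on the chosen proof.
record SignedGraph : Set₁ where
  field
    graph : Graph
  open Graph graph public
  field
    σ      : ∀ {u v} → u ~ v → Sign
    σ-edge : ∀ {u v} (e : u ~ v) (f : v ~ u) → σ e ≡ σ f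

AllPositive : SignedGraph → Set
AllPositive S = ∀ {u v} (e : u ~ v) → σ e ≡ Sign.+
  where open SignedGraph S

data Ω : Set where
  -1ω 0ω 1ω : Ω

⟦_⟧ : Ω → ℤ
⟦ -1ω ⟧ = -1ℤ
⟦ 0ω ⟧  = 0ℤ
⟦ 1ω ⟧  = 1ℤ

-- The standard inner product of ℝᵏ; on Ωᵏ it takes integer values.
⟨_,_⟩ : ∀ {k} → Vec Ω k → Vec Ω k → ℤ
⟨ [] , [] ⟩         = 0ℤ
⟨ x ∷ xs , y ∷ ys ⟩ = ⟦ x ⟧ ℤ.* ⟦ y ⟧ ℤ.+ ⟨ xs , ys ⟩

⟨⟩-comm : ∀ {k} (x y : Vec Ω k) → ⟨ x , y ⟩ ≡ ⟨ y , x ⟩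
⟨⟩-comm []       []       = refl
⟨⟩-comm (x ∷ xs) (y ∷ ys) = cong₂ ℤ._+_ (ℤ.*-comm ⟦ x ⟧ ⟦ y ⟧) (⟨⟩-comm xs ys)

record SwitchingFunction (S : SignedGraph) (k : ℕ) : Set where
  open SignedGraph S
  field
    ζ       : V → Vec Ω k
    nonzero : ∀ {u v} → u ~ v → ⟨ ζ u , ζ v ⟩ ≢ 0ℤ

-- The library's  sign  sends 0 to +, but it is applied here only to the
-- nonzero inner products along edges, where it is sgn.
_^_ : (S : SignedGraph) → ∀ {k} → SwitchingFunction S k → SignedGraph
S ^ Z = record
  { graph  = graph
  ; σ      = λ {u} {v} e → σ e Sign.* sign ⟨ ζ u , ζ v ⟩
  ; σ-edge = λ {u} {v} e f →
      cong₂ Sign._*_ (σ-edge e f) (cong sign (⟨⟩-comm (ζ u) (ζ v)))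
  }
  where open SignedGraph S; open SwitchingFunction Z

Balanceable : SignedGraph → ℕ → Set
Balanceable S k = Σ (SwitchingFunction S k) λ Z → AllPositive (S ^ Z)

record IsBdim (S : SignedGraph) (k : ℕ) : Set where
  field
    positive : 1 ≤ k
    attained : Balanceable S k
    minimal  : ∀ {j} → 1 ≤ j → Balanceable S j → k ≤ j

-- The lexicographic product G₁ [ G₂ ]ᴳ and, on top of it, the HG-lexicographic
-- product of signed graphs.
_[_]ᴳ : Graph → Graph → Graph
G₁ [ G₂ ]ᴳ = record
  { V        = G₁.V × G₂.V
  ; order    = G₁.order ℕ.* G₂.order
  ; finite   = ↔-trans (G₁.finite ×-↔ G₂.finite) (↔-sym *↔×)
  ; _~_      = λ (u , v) (u′ , v′) → u G₁.~ u′ ⊎ (u ≡ u′ × v G₂.~ v′)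
  ; _~?_     = λ (u , v) (u′ , v′) →
                 (u G₁.~? u′) ⊎-dec ((u G₁.≟ u′) ×-dec (v G₂.~? v′))
  ; ~-sym    = [ inj₁ ∘ G₁.~-sym , (λ (p , e) → inj₂ (sym p , G₂.~-sym e)) ]
  ; ~-irrefl = [ G₁.~-irrefl , (λ (_ , e) → G₂.~-irrefl e) ]
  }
  where module G₁ = Graph G₁; module G₂ = Graph G₂

_[_] : SignedGraph → SignedGraph → SignedGraph
S₁ [ S₂ ] = record
  { graph  = S₁.graph [ S₂.graph ]ᴳ
  ; σ      = [ S₁.σ , (λ (_ , e) → S₂.σ e) ]
  ; σ-edge = λ where
      (inj₁ e)       (inj₁ f)       → S₁.σ-edge e f
      (inj₂ (_ , e)) (inj₂ (_ , f)) → S₂.σ-edge e f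
      (inj₁ e) (inj₂ (refl , _))    → contradiction e S₁.~-irrefl
      (inj₂ (refl , _)) (inj₁ f)    → contradiction f S₁.~-irrefl
  }
  where module S₁ = SignedGraph S₁; module S₂ = SignedGraph S₂

-- The rest shows that a least dimension always exists, so that bdim is a
-- function.  First, Balanceable S k is decidable, by exhaustive search.

Searchable : Set → Set₁
Searchable A = ∀ {P : A → Set} → (∀ a → Dec (P a)) → Dec (∃ P)

Ω-search : Searchable Ω
Ω-search P? = map′
  (λ { (inj₁ p) → -1ω , p ; (inj₂ (inj₁ p)) → 0ω , p ; (inj₂ (inj₂ p)) → 1ω , p })
  (λ { (-1ω , p) → inj₁ p ; (0ω , p) → inj₂ (inj₁ p) ; (1ω , p) → inj₂ (inj₂ p) })
  (P? -1ω ⊎-dec (P? 0ω ⊎-dec P? 1ω))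

Vec-search : ∀ {A} → Searchable A → ∀ n → Searchable (Vec A n)
Vec-search s zero    P? = map′ ([] ,_) (λ { ([] , p) → p }) (P? [])
Vec-search s (suc n) P? = map′
  (λ (a , as , p) → a ∷ as , p)
  (λ { (a ∷ as , p) → a , as , p })
  (s λ a → Vec-search s n λ as → P? (a ∷ as))

module _ (S : SignedGraph) where
  open SignedGraph S
  open Inverse finite using (to; from; strictlyInverseʳ)

  σ-unique : ∀ {u v} (e f : u ~ v) → σ e ≡ σ f
  σ-unique e f = trans (σ-edge e (~-sym e)) (sym (σ-edge f (~-sym e)))

  V-all? : {P : V → Set} → (∀ v → Dec (P v)) → Dec (∀ v → P v)
  V-all? {P} P? = map′
    (λ p v → subst P (strictlyInverseʳ v) (p (to v)))
    (λ p i → p (from i))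
    (Fin.all? (P? ∘ from))

  Fits : ∀ {k} → V → V → Vec Ω k → Vec Ω k → Set
  Fits u v x y = (e : u ~ v) →
    ⟨ x , y ⟩ ≢ 0ℤ × σ e Sign.* sign ⟨ x , y ⟩ ≡ Sign.+

  Fits? : ∀ {k} u v (x y : Vec Ω k) → Dec (Fits u v x y)
  Fits? u v x y with u ~? v
  ... | no ¬e = yes λ e → contradiction e ¬e
  ... | yes e = map′
    (λ (p , q) f → p , trans (cong (Sign._* _) (σ-unique f e)) q)
    (λ h → h e)
    (¬? (⟨ x , y ⟩ ℤ.≟ 0ℤ) ×-dec (σ e Sign.* sign ⟨ x , y ⟩ Sign.≟ Sign.+))

  fits⇒balanceable : ∀ {k} (ζ : V → Vec Ω k) →
    (∀ u v → Fits u v (ζ u) (ζ v)) → Balanceable S k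
  fits⇒balanceable ζ h =
    record { ζ = ζ ; nonzero = λ e → proj₁ (h _ _ e) } , λ e → proj₂ (h _ _ e)

  balanceable? : ∀ k → Dec (Balanceable S k)
  balanceable? k = map′
    (λ (z , h) → fits⇒balanceable (at z) h)
    (λ (Z , h) → let open SwitchingFunction Z in
      table ζ , λ u v → subst₂ (Fits u v) (sym (at-table ζ u)) (sym (at-table ζ v))
                          (λ e → nonzero e , h e))
    (Vec-search (Vec-search Ω-search k) order λ z →
      V-all? λ u → V-all? λ v → Fits? u v (at z u) (at z v))
    where
    at : Vec (Vec Ω k) order → V → Vec Ω k
    at z v = Vec.lookup z (to v)

    table : (V → Vec Ω k) → Vec (Vec Ω k) order
    table ζ = Vec.tabulate (ζ ∘ from)

    at-table : ∀ ζ v → at (table ζ) v ≡ ζ v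
    at-table ζ v = trans (Vec.lookup∘tabulate _ (to v)) (cong ζ (strictlyInverseʳ v))

  -- Second, some dimension works: use one coordinate per ordered pair (i , j).
  -- If i ~ j, that coordinate is 1 at i, the sign of ij at j, and 0 elsewhere;
  -- otherwise it vanishes.  Along an edge uv only the coordinates (u , v) and
  -- (v , u) contribute, and each contributes the sign of uv.

  signω : Sign → Ω
  signω Sign.- = -1ω
  signω Sign.+ = 1ω

  coord : V × V → V → Ω
  coord (i , j) u with i ~? j | u ≟ i | u ≟ j
  ... | no _  | _     | _     = 0ω
  ... | yes _ | yes _ | _     = 1ω
  ... | yes e | no _  | yes _ = signω (σ e)
  ... | yes _ | no _  | no _  = 0ω

  signω-1 : ∀ s → ⟦ signω s ⟧ ℤ.* 1ℤ ≡ s ◃ 1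
  signω-1 Sign.- = refl
  signω-1 Sign.+ = refl

  1-signω : ∀ s → 1ℤ ℤ.* ⟦ signω s ⟧ ≡ s ◃ 1
  1-signω Sign.- = refl
  1-signω Sign.+ = refl

  coord-edge : ∀ p {u v} (e : u ~ v) → ∃ λ m →
    ⟦ coord p u ⟧ ℤ.* ⟦ coord p v ⟧ ≡ σ e ◃ m × (p ≡ (u , v) → 1 ≤ m)
  coord-edge (i , j) {u} {v} e with i ~? j | u ≟ i | u ≟ j | v ≟ i | v ≟ j
  ... | no ¬f | _ | _ | _ | _ = 0 , refl , λ { refl → contradiction e ¬f }
  ... | yes _ | yes refl | _ | yes refl | _ = contradiction e ~-irrefl
  ... | yes f | yes refl | _ | no _ | yes refl =
    1 , trans (1-signω (σ f)) (cong (_◃ 1) (σ-unique f e)) , λ _ → s≤s z≤n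
  ... | yes _ | yes refl | _ | no _ | no v≢j =
    0 , refl , λ { refl → contradiction refl v≢j }
  ... | yes f | no _ | yes refl | yes refl | _ =
    1 , trans (signω-1 (σ f)) (cong (_◃ 1) (σ-edge f e)) , λ _ → s≤s z≤n
  ... | yes _ | no _ | yes refl | no _ | yes refl = contradiction e ~-irrefl
  ... | yes f | no u≢i | yes refl | no _ | no _ =
    0 , ℤ.*-zeroʳ ⟦ signω (σ f) ⟧ , λ { refl → contradiction refl u≢i }
  ... | yes _ | no u≢i | no _ | _ | _ =
    0 , refl , λ { refl → contradiction refl u≢i }

  coords : (ps : List (V × V)) → V → Vec Ω (List.length ps)
  coords []       u = []
  coords (p ∷ ps) u = coord p u ∷ coords ps u

  coords-edge : ∀ ps {u v} (e : u ~ v) → ∃ λ m →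
    ⟨ coords ps u , coords ps v ⟩ ≡ σ e ◃ m × ((u , v) ∈ ps → 1 ≤ m)
  coords-edge []       e = 0 , refl , λ ()
  coords-edge (p ∷ ps) e
    with m , eq , pos ← coord-edge p e | n , eqs , poss ← coords-edge ps e =
    m ℕ.+ n ,
    trans (cong₂ ℤ._+_ eq eqs) (sym (ℤ.◃-distrib-+ (σ e) m n)) ,
    λ { (here refl) → ℕ.≤-trans (pos refl) (ℕ.m≤m+n m n)
      ; (there q)   → ℕ.≤-trans (poss q) (ℕ.m≤n+m n m) }

  vertices : List V
  vertices = List.map from (List.allFin order)

  ∈-vertices : ∀ v → v ∈ vertices
  ∈-vertices v = subst (_∈ vertices) (strictlyInverseʳ v) (∈-map⁺ from (∈-allFin (to v)))

  pairs : List (V × V)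
  pairs = List.cartesianProduct vertices vertices

  -- The leading zero coordinate only makes the dimension at least 1.
  balanceable : Balanceable S (suc (List.length pairs))
  balanceable = fits⇒balanceable (λ u → 0ω ∷ coords pairs u) fits
    where
    fits : ∀ u v → Fits u v (0ω ∷ coords pairs u) (0ω ∷ coords pairs v)
    fits u v e with coords-edge pairs e
    ... | m , eq , pos with pos (∈-cartesianProduct⁺ (∈-vertices u) (∈-vertices v))
    ... | s≤s {n = n} _ rewrite ℤ.+-identityˡ ⟨ coords pairs u , coords pairs v ⟩ | eq =
      (λ z → contradiction (trans (sym (ℤ.abs-◃ (σ e) (suc n))) (cong ℤ.∣_∣ z)) λ ()) ,
      trans (cong (σ e Sign.*_) (ℤ.sign-◃ (σ e) (suc n))) (Sign.s*s≡+ (σ e))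

least : ∀ {P : ℕ → Set} → (∀ n → Dec (P n)) → ∀ n → P n →
  ∃ λ m → P m × (∀ {j} → P j → m ≤ j)
least P? zero    p = 0 , p , λ _ → z≤n
least {P} P? (suc n) p with P? 0
... | yes p₀ = 0 , p₀ , λ _ → z≤n
... | no ¬p₀ with m , q , min ← least (P? ∘ suc) n p =
  suc m , q , λ { {zero} r → contradiction r ¬p₀ ; {suc j} r → s≤s (min r) }

bdim-exists : ∀ S → ∃ (IsBdim S)
bdim-exists S
  with m , b , min ← least (balanceable? S ∘ suc) (List.length (pairs S)) (balanceable S) =
  suc m , record
    { positive = s≤s z≤n
    ; attained = b
    ; minimal  = λ { {suc j} _ r → s≤s (min r) }
    }

bdim : SignedGraph → ℕ
bdim S = proj₁ (bdim-exists S)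

bdim-isBdim : ∀ S → IsBdim S (bdim S)
bdim-isBdim S = proj₂ (bdim-exists S)

{-# OPTIONS --safe #-}
-- Fixing a vertex v of Σ₂, the map u ↦ (u , v) embeds Σ₁ in Σ₁ [ Σ₂ ], which
-- gives one inequality.  Conversely, use the vector of u at every (u , v): on
-- an edge within a fibre the inner product is ⟨ ζ u , ζ u ⟩, which is positive
-- unless ζ u = 0.  In that case u is isolated, and ζ u can be replaced by
-- (1 , … , 1).
module Submission where

open import Defs
open import Data.Integer using (0ℤ; +_)
open import Data.Integer.Properties using (+-identityˡ)
open import Data.Nat using (ℕ; zero; suc; _≤_)
open import Data.Nat.Properties using (≤-antisym)
open import Data.Product using (∃; _,_)
open import Data.Sum using (inj₁; inj₂)
open import Data.Vec using (Vec; []; _∷_; replicate)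
open import Relation.Binary.PropositionalEquality
  using (_≡_; _≢_; refl; trans; cong; cong₂)
open import Relation.Nullary using (contradiction)

-- Valued in `ℕ`, so that `⟨ x , x ⟩` is nonnegative by its form and the zero vector is detected by
-- matching.
‖_‖² : ∀ {k} → Vec Ω k → ℕ
‖ [] ‖²       = 0
‖ -1ω ∷ x ‖² = suc ‖ x ‖²
‖ 0ω ∷ x ‖²  = ‖ x ‖²
‖ 1ω ∷ x ‖²  = suc ‖ x ‖²

⟨x,x⟩≡‖x‖² : ∀ {k} (x : Vec Ω k) → ⟨ x , x ⟩ ≡ + ‖ x ‖²
⟨x,x⟩≡‖x‖² []         = refl
⟨x,x⟩≡‖x‖² (-1ω ∷ x) rewrite ⟨x,x⟩≡‖x‖² x = refl
⟨x,x⟩≡‖x‖² (0ω ∷ x)  rewrite ⟨x,x⟩≡‖x‖² x = refl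
⟨x,x⟩≡‖x‖² (1ω ∷ x)  rewrite ⟨x,x⟩≡‖x‖² x = refl

-- A nonzero first entry would make the squared norm a successor, so only `0ω` can occur.
‖x‖²≡0⇒⟨x,y⟩≡0 : ∀ {k} (x y : Vec Ω k) → ‖ x ‖² ≡ 0 → ⟨ x , y ⟩ ≡ 0ℤ
‖x‖²≡0⇒⟨x,y⟩≡0 []        []      _ = refl
‖x‖²≡0⇒⟨x,y⟩≡0 (0ω ∷ x) (_ ∷ y) p =
  trans (+-identityˡ ⟨ x , y ⟩) (‖x‖²≡0⇒⟨x,y⟩≡0 x y p)

replaceZero : ∀ {k} → Vec Ω k → Vec Ω k
replaceZero x with ‖ x ‖²
... | zero  = replicate _ 1ω
... | suc _ = x

replaceZero-positive : ∀ {k} → 1 ≤ k → (x : Vec Ω k) →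
  ∃ λ n → ⟨ replaceZero x , replaceZero x ⟩ ≡ + suc n
replaceZero-positive {suc k} _ x with ‖ x ‖² in eq
-- The index `suc k` matters: the all-ones vector is nonzero only if it has a coordinate.
... | zero  = _ , ⟨x,x⟩≡‖x‖² (replicate (suc k) 1ω)
... | suc n = n , trans (⟨x,x⟩≡‖x‖² x) (cong +_ eq)

-- The zero vector is orthogonal to everything, so `y` certifies that `x` is kept.
replaceZero-id : ∀ {k} (x y : Vec Ω k) → ⟨ x , y ⟩ ≢ 0ℤ → replaceZero x ≡ x
replaceZero-id x y xy≢0 with ‖ x ‖² in eq
... | zero  = contradiction (‖x‖²≡0⇒⟨x,y⟩≡0 x y eq) xy≢0
... | suc _ = refl

⟨⟩-replaceZero : ∀ {k} (x y : Vec Ω k) → ⟨ x , y ⟩ ≢ 0ℤ →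
  ⟨ replaceZero x , replaceZero y ⟩ ≡ ⟨ x , y ⟩
⟨⟩-replaceZero x y xy≢0 = cong₂ ⟨_,_⟩
  (replaceZero-id x y xy≢0)
  (replaceZero-id y x λ yx≡0 → xy≢0 (trans (⟨⟩-comm x y) yx≡0))

module _ (Σ₁ Σ₂ : SignedGraph) where
  private
    module Σ₁ = SignedGraph Σ₁
    module Σ₂ = SignedGraph Σ₂

  balanceable-factor : ∀ {k} → Σ₂.V → Balanceable (Σ₁ [ Σ₂ ]) k → Balanceable Σ₁ k
  balanceable-factor v (Z , pos) =
    record { ζ = λ u → ζ (u , v) ; nonzero = λ e → nonzero (inj₁ e) } ,
    λ e → pos (inj₁ e)
    where open SwitchingFunction Z

  -- Dimension 0 must be excluded: it balances an edgeless `Σ₁`, but an edge within a fibre needs a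
  -- nonzero vector.
  balanceable-product : ∀ {k} → 1 ≤ k → AllPositive Σ₂ →
    Balanceable Σ₁ k → Balanceable (Σ₁ [ Σ₂ ]) k
  balanceable-product {k} 1≤k pos₂ (Z , pos) =
    fits⇒balanceable (Σ₁ [ Σ₂ ]) ζ′ fits
    where
    open SwitchingFunction Z

    ζ′ : SignedGraph.V (Σ₁ [ Σ₂ ]) → Vec Ω k
    ζ′ (u , _) = replaceZero (ζ u)

    fits : ∀ p q → Fits (Σ₁ [ Σ₂ ]) p q (ζ′ p) (ζ′ q)
    -- Neither end of `e` had its vector replaced, so the signs are those of the balanced `Σ₁`.
    fits (u , _) (u′ , _) (inj₁ e)
      rewrite ⟨⟩-replaceZero (ζ u) (ζ u′) (nonzero e) = nonzero e , pos e
    fits (u , _) _ (inj₂ (refl , f))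
      with n , eq ← replaceZero-positive 1≤k (ζ u)
      rewrite eq | pos₂ f = (λ ()) , refl

theorem2p18 : (Σ₁ Σ₂ : SignedGraph) →
    Connected (SignedGraph.graph Σ₁) → Connected (SignedGraph.graph Σ₂) →
    AllPositive Σ₂ → bdim (Σ₁ [ Σ₂ ]) ≡ bdim Σ₁
theorem2p18 Σ₁ Σ₂ _ connected₂ pos₂ = ≤-antisym
  (P.minimal F.positive (balanceable-product Σ₁ Σ₂ F.positive pos₂ F.attained))
  (F.minimal P.positive
    -- Connectedness of `Σ₂` supplies the vertex that fixes a copy of `Σ₁`.
    (balanceable-factor Σ₁ Σ₂ (Connected.nonempty connected₂) P.attained))
  where
  module F = IsBdim (bdim-isBdim Σ₁)
  module P = IsBdim (bdim-isBdim (Σ₁ [ Σ₂ ]))
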